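{- Let $s,t,k$ be non-negative integers with $t \le A(s,2k-2,k)$. For every family $\mathscr{F}$ of $t$ graphs, each having $n$ vertices and being $p$-almost equitably $k$-colorable, \[ \mathscr{U}(\mathscr{F}) ~\le~ s\left\lceil \frac{n-p}{k}\right\rceil + tp . \]
   Context: All graphs are finite and simple. A graph $U$ is an induced-universal graph for a family $\mathscr{F}$ if every graph of $\mathscr{F}$ is isomorphic to an induced subgraph of $U$; $\mathscr{U}(\mathscr{F})$ is the smallest number of vertices of such a $U$. A $k$-coloring is equitable if its $k$ color classes (stable sets) have sizes pairwise differing by at most one; a graph $G$ is $p$-almost equitably $k$-colorable if there is a set $X$ of at most $p$ vertices such that $G\setminus X$ has an equitable $k$-coloring. $A(n,d,w)$ denotes the maximum number of binary words of length $n$ and Hamming weight $w$ that are pairwise at Hamming distance at least $d$; equivalently $A(n,2k-2,k)$ is the maximum number of pairwise edge-disjoint copies of $K_k$ in $K_n$.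
   Formalization: k is taken to be at least 1, and n−p is read as max(n−p,0): for p>n the literal bound can be negative and false, e.g. k=1, s=3, t=1, n=1, p=2 gives −1 while a one-vertex graph needs one vertex. -}

module Defs where

open import Data.Bool.Base using (Bool; true; false; _xor_; _∧_; if_then_else_)
import Data.Bool.Properties as Bool
open import Data.Fin.Base using (Fin; zero; suc; combine; remQuot)
open import Data.Fin.Properties using
  (_≟_; all?; any?; injective⇒≤; combine-injective; remQuot-combine)
open import Data.Fin.Subset using (Subset; _∈_; ∁; ∣_∣)
open import Data.Fin.Subset.Properties using (anySubset?)
open import Data.Nat.Base using
  (ℕ; zero; suc; _+_; _*_; _^_; _≤_; z≤n; s≤s; NonZero; pred)
open import Data.Nat.DivMod using (_/_)
import Data.Nat.Properties as ℕ
open import Data.Product.Base using (∃; _×_; _,_; proj₁; proj₂)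
open import Data.Vec.Base using (Vec; []; _∷_; lookup; tabulate; zipWith)
open import Data.Vec.Properties using
  (lookup∘tabulate; []=⇒lookup; lookup⇒[]=; ≡-dec)
open import Data.Vec.Properties.WithK using ([]=-irrelevant)
open import Data.Vec.Relation.Unary.All using (All; []; _∷_)
import Data.Vec.Relation.Unary.All as All
open import Data.Vec.Relation.Unary.AllPairs using (AllPairs; []; _∷_)
import Data.Vec.Relation.Unary.AllPairs as AllPairs
open import Data.Vec.Relation.Unary.Unique.Propositional.Properties
  using (lookup-injective)
open import Function.Base using (_∘_)
open import Function.Bundles using (_↔_; mk↔ₛ′; Inverse)
open import Relation.Binary.PropositionalEquality
  using (_≡_; _≢_; refl; sym; trans; cong; cong₂)
open import Relation.Nullary.Decidable
  using (Dec; yes; no; does; map′; _×-dec_; _→-dec_; ¬?; dec-true)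
open import Relation.Nullary.Negation using (contradiction)
open import Relation.Unary using (Decidable)

⌈_/_⌉ : (m k : ℕ) .{{_ : NonZero k}} → ℕ
⌈ m / k ⌉ = (m + pred k) / k

IsMinimum : (ℕ → Set) → ℕ → Set
IsMinimum P m = P m × (∀ l → P l → m ≤ l)

IsMaximum : (ℕ → Set) → ℕ → Set
IsMaximum P m = P m × (∀ l → P l → l ≤ m)

-- A graph with n vertices is a Graph (Fin n).  The vertex type is a
-- parameter because an induced subgraph has vertex type ∃ (_∈ S).

record Graph (V : Set) : Set where
  field
    adj        : V → V → Bool
    adj-sym    : ∀ x y → adj x y ≡ adj y x
    adj-irrefl : ∀ x → adj x x ≡ false

open Graph public

infix 4 _≅_ _⊑_

record _≅_ {V W : Set} (G : Graph V) (H : Graph W) : Set where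
  field
    vertices  : V ↔ W
    adjacency : ∀ x y →
      adj H (Inverse.to vertices x) (Inverse.to vertices y) ≡ adj G x y

_[_] : ∀ {n} → Graph (Fin n) → (S : Subset n) → Graph (∃ (_∈ S))
G [ S ] = record
  { adj        = λ x y → adj G (proj₁ x) (proj₁ y)
  ; adj-sym    = λ x y → adj-sym G (proj₁ x) (proj₁ y)
  ; adj-irrefl = λ x → adj-irrefl G (proj₁ x)
  }

_∖_ : ∀ {n} → Graph (Fin n) → (X : Subset n) → Graph (∃ (_∈ ∁ X))
G ∖ X = G [ ∁ X ]

_⊑_ : ∀ {V n} → Graph V → Graph (Fin n) → Set
G ⊑ U = ∃ λ S → G ≅ U [ S ]

IsInducedUniversal : ∀ {t n m} → (Fin t → Graph (Fin n)) → Graph (Fin m) → Set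
IsInducedUniversal F U = ∀ i → F i ⊑ U

HasInducedUniversal : ∀ {t n} → (Fin t → Graph (Fin n)) → ℕ → Set
HasInducedUniversal F m = ∃ λ (U : Graph (Fin m)) → IsInducedUniversal F U

record EquitableColoring {V : Set} (k : ℕ) (G : Graph V) : Set where
  field
    color      : V → Fin k
    proper     : ∀ x y → adj G x y ≡ true → color x ≢ color y
    size       : Fin k → ℕ
    class-size : ∀ c → (∃ λ x → color x ≡ c) ↔ Fin (size c)
    equitable  : ∀ c d → size c ≤ suc (size d)

AlmostEquitablyColorable : ∀ {n} → (p k : ℕ) → Graph (Fin n) → Set
AlmostEquitablyColorable p k G =
  ∃ λ X → ∣ X ∣ ≤ p × EquitableColoring k (G ∖ X)

Word : ℕ → Set
Word n = Vec Bool n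

weight : ∀ {n} → Word n → ℕ
weight x = ∣ x ∣

hamming : ∀ {n} → Word n → Word n → ℕ
hamming x y = weight (zipWith _xor_ x y)

-- Distinctness follows from the distance condition only when d > 0; for
-- d = 0 it is what makes a code a set of words.
Code : (n d w m : ℕ) → Set
Code n d w m = ∃ λ (C : Vec (Word n) m) →
  All (λ x → weight x ≡ w) C × AllPairs (λ x y → x ≢ y × d ≤ hamming x y) C

minimum : ∀ {P : ℕ → Set} → Decidable P → ∀ b → P b → ∃ (IsMinimum P)
minimum P? b Pb with P? 0
minimum P? b       Pb | yes P0 = 0 , P0 , λ _ _ → z≤n
minimum P? zero    Pb | no ¬P0 = contradiction Pb ¬P0
minimum P? (suc b) Pb | no ¬P0 with minimum (P? ∘ suc) b Pb
... | m , Pm , least = suc m , Pm , λ where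
  zero    P0 → contradiction P0 ¬P0
  (suc l) Pl → s≤s (least l Pl)

maximum : ∀ {P : ℕ → Set} → Decidable P → P 0 →
          ∀ b → (∀ l → P l → l ≤ b) → ∃ (IsMaximum P)
maximum P? P0 zero    bound = 0 , P0 , bound
maximum P? P0 (suc b) bound with P? (suc b)
... | yes Pb = suc b , Pb , bound
... | no ¬Pb = maximum P? P0 b λ l Pl →
  ℕ.≤-pred (ℕ.≤∧≢⇒< (bound l Pl) λ { refl → ¬Pb Pl })

anyVec? : ∀ {A : Set} →
          (∀ {P : A → Set} → Decidable P → Dec (∃ P)) →
          ∀ {n} {P : Vec A n → Set} → Decidable P → Dec (∃ P)
anyVec? any {zero}  P? = map′ ([] ,_) (λ { ([] , p) → p }) (P? [])
anyVec? any {suc n} P? =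
  map′ (λ (x , xs , p) → x ∷ xs , p) (λ { (x ∷ xs , p) → x , xs , p })
       (any λ x → anyVec? any λ xs → P? (x ∷ xs))

code? : ∀ n d w → Decidable (Code n d w)
code? n d w m = anyVec? anySubset? λ C →
  All.all? (λ x → weight x ℕ.≟ w) C ×-dec
  AllPairs.allPairs?
    (λ x y → ¬? (≡-dec Bool._≟_ x y) ×-dec (d ℕ.≤? hamming x y)) C

bit : Bool → Fin 2
bit b = if b then suc zero else zero

bit-injective : ∀ b c → bit b ≡ bit c → b ≡ c
bit-injective true  true  _ = refl
bit-injective false false _ = refl

encode : ∀ {n} → Word n → Fin (2 ^ n)
encode []      = zero
encode (b ∷ x) = combine (bit b) (encode x)

encode-injective : ∀ {n} (x y : Word n) → encode x ≡ encode y → x ≡ y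
encode-injective []      []      _  = refl
encode-injective (b ∷ x) (c ∷ y) eq
  with combine-injective (bit b) (encode x) (bit c) (encode y) eq
... | b≡c , x≡y = cong₂ _∷_ (bit-injective b c b≡c) (encode-injective x y x≡y)

code-size≤2^n : ∀ n d w m → Code n d w m → m ≤ 2 ^ n
code-size≤2^n n d w m (C , _ , separated) =
  injective⇒≤ {f = encode ∘ lookup C} λ {i} {j} eq →
    lookup-injective (AllPairs.map proj₁ separated) i j
      (encode-injective (lookup C i) (lookup C j) eq)

A-exists : ∀ n d w → ∃ (IsMaximum (Code n d w))
A-exists n d w =
  maximum (code? n d w) ([] , [] , []) (2 ^ n) (code-size≤2^n n d w)

A : (n d w : ℕ) → ℕ
A n d w = proj₁ (A-exists n d w)

A-isMaximum : ∀ n d w → IsMaximum (Code n d w) (A n d w)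
A-isMaximum n d w = proj₂ (A-exists n d w)

IsEmbedding : ∀ {V W : Set} → (V → V → Bool) → (W → W → Bool) → (V → W) → Set
IsEmbedding a b f =
  (∀ x y → f x ≡ f y → x ≡ y) × (∀ x y → b (f x) (f y) ≡ a x y)

embedding-resp-≗ : ∀ {V W : Set} {a : V → V → Bool} {b : W → W → Bool} {f g} →
                   (∀ x → g x ≡ f x) → IsEmbedding a b f → IsEmbedding a b g
embedding-resp-≗ {b = b} g≗f (inj , pres) =
  (λ x y eq → inj x y (trans (sym (g≗f x)) (trans eq (g≗f y)))) ,
  (λ x y → trans (cong₂ b (g≗f x) (g≗f y)) (pres x y))

embedding? : ∀ {n m} (a : Fin n → Fin n → Bool) (b : Fin m → Fin m → Bool) →
             Dec (∃ (IsEmbedding a b))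
embedding? a b = map′
  (λ (v , e) → lookup v , e)
  (λ (f , e) → tabulate f , embedding-resp-≗ {a = a} {b} (lookup∘tabulate f) e)
  (anyVec? any? λ v →
    all? (λ x → all? λ y → (lookup v x ≟ lookup v y) →-dec (x ≟ y)) ×-dec
    all? (λ x → all? λ y → b (lookup v x) (lookup v y) Bool.≟ a x y))

∈-≡ : ∀ {n} {S : Subset n} (u v : ∃ (_∈ S)) → proj₁ u ≡ proj₁ v → u ≡ v
∈-≡ (u , p) (.u , q) refl = cong (u ,_) ([]=-irrelevant p q)

⊑⇒embedding : ∀ {V m} (G : Graph V) (U : Graph (Fin m)) →
              G ⊑ U → ∃ (IsEmbedding (adj G) (adj U))
⊑⇒embedding G U (S , iso) = proj₁ ∘ to ,
  (λ x y eq → trans (sym (strictlyInverseʳ x))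
    (trans (cong from (∈-≡ (to x) (to y) eq)) (strictlyInverseʳ y))) ,
  _≅_.adjacency iso
  where
  open Inverse (_≅_.vertices iso)

embedding⇒⊑ : ∀ {n m} (G : Graph (Fin n)) (U : Graph (Fin m)) →
              ∃ (IsEmbedding (adj G) (adj U)) → G ⊑ U
embedding⇒⊑ {n} {m} G U (f , inj , pres) = image , record
  { vertices  = mk↔ₛ′ to (proj₁ ∘ preimage) to∘from
                  (λ x → inj _ x (proj₂ (preimage (to x))))
  ; adjacency = pres
  }
  where
  hit? : ∀ u → Dec (∃ λ x → f x ≡ u)
  hit? u = any? λ x → f x ≟ u

  image : Subset m
  image = tabulate (does ∘ hit?)

  to : Fin n → ∃ (_∈ image)
  to x = f x , lookup⇒[]= (f x) image
    (trans (lookup∘tabulate _ (f x)) (dec-true (hit? (f x)) (x , refl)))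

  preimage : (u : ∃ (_∈ image)) → ∃ λ x → f x ≡ proj₁ u
  preimage (u , u∈)
    with hit? u | trans (sym (lookup∘tabulate (does ∘ hit?) u)) ([]=⇒lookup u∈)
  ... | yes h | _ = h
  ... | no  _ | ()

  to∘from : ∀ u → to (proj₁ (preimage u)) ≡ u
  to∘from u = ∈-≡ _ u (proj₂ (preimage u))

hasInducedUniversal? : ∀ {t n} (F : Fin t → Graph (Fin n)) →
                       Decidable (HasInducedUniversal F)
hasInducedUniversal? F m = map′
  (λ (M , (s , r) , e) →
    let U = record { adj = entry M ; adj-sym = s ; adj-irrefl = r }
    in U , λ i → embedding⇒⊑ (F i) U (e i))
  (λ (U , e) → matrix U ,
    ( (λ x y → trans (entry-matrix U x y)
                 (trans (adj-sym U x y) (sym (entry-matrix U y x))))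
    , (λ x → trans (entry-matrix U x x) (adj-irrefl U x)) ) ,
    λ i → let f , inj , pres = ⊑⇒embedding (F i) U (e i) in
      f , inj , λ x y → trans (entry-matrix U (f x) (f y)) (pres x y))
  (anyVec? anySubset? λ M →
    (all? (λ x → all? λ y → entry M x y Bool.≟ entry M y x) ×-dec
     all? (λ x → entry M x x Bool.≟ false)) ×-dec
    all? (λ i → embedding? (adj (F i)) (entry M)))
  where
  entry : Vec (Vec Bool m) m → Fin m → Fin m → Bool
  entry M x y = lookup (lookup M x) y

  matrix : Graph (Fin m) → Vec (Vec Bool m) m
  matrix U = tabulate λ x → tabulate (adj U x)

  entry-matrix : ∀ U x y → entry (matrix U) x y ≡ adj U x y
  entry-matrix U x y = trans
    (cong (λ row → lookup row y) (lookup∘tabulate (λ x → tabulate (adj U x)) x))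
    (lookup∘tabulate (adj U x) y)

disjointUnion : ∀ {t n} → (Fin t → Graph (Fin n)) → Graph (Fin t × Fin n)
disjointUnion {t} {n} F = record
  { adj        = a
  ; adj-sym    = a-sym
  ; adj-irrefl = a-irrefl
  }
  where
  a : Fin t × Fin n → Fin t × Fin n → Bool
  a (i , x) (j , y) = does (i ≟ j) ∧ adj (F i) x y

  a-sym : ∀ u v → a u v ≡ a v u
  a-sym (i , x) (j , y) with i ≟ j | j ≟ i
  ... | yes refl | yes _   = adj-sym (F i) x y
  ... | yes refl | no  j≢i = contradiction refl j≢i
  ... | no  i≢j  | yes j≡i = contradiction (sym j≡i) i≢j
  ... | no  _    | no  _   = refl

  a-irrefl : ∀ u → a u u ≡ false
  a-irrefl (i , x) = trans (cong (does (i ≟ i) ∧_) (adj-irrefl (F i) x))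
                           (Bool.∧-zeroʳ _)

disjointUnion-universal : ∀ {t n} (F : Fin t → Graph (Fin n)) →
                          HasInducedUniversal F (t * n)
disjointUnion-universal {t} {n} F = U , λ i → embedding⇒⊑ (F i) U
  ( combine i
  , (λ x y eq → proj₂ (combine-injective i x i y eq))
  , λ x y → trans
      (cong₂ (adj (disjointUnion F)) (remQuot-combine i x) (remQuot-combine i y))
      (cong (_∧ adj (F i) x y) (dec-true (i ≟ i) refl)) )
  where
  U : Graph (Fin (t * n))
  U = record
    { adj        = λ u v → adj (disjointUnion F) (remQuot n u) (remQuot n v)
    ; adj-sym    = λ u v → adj-sym (disjointUnion F) (remQuot n u) (remQuot n v)
    ; adj-irrefl = λ u → adj-irrefl (disjointUnion F) (remQuot n u)
    }

𝒰-exists : ∀ {t n} (F : Fin t → Graph (Fin n)) →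
           ∃ (IsMinimum (HasInducedUniversal F))
𝒰-exists {t} {n} F =
  minimum (hasInducedUniversal? F) (t * n) (disjointUnion-universal F)

𝒰 : ∀ {t n} → (Fin t → Graph (Fin n)) → ℕ
𝒰 F = proj₁ (𝒰-exists F)

𝒰-isMinimum : ∀ {t n} (F : Fin t → Graph (Fin n)) →
              IsMinimum (HasInducedUniversal F) (𝒰 F)
𝒰-isMinimum F = proj₂ (𝒰-exists F)

{-# OPTIONS --safe #-}

-- Each graph splits into k stable sets of at most q = ⌈(n − p)/k⌉ vertices and
-- at most p further vertices.  Take s stable blobs of q vertices and, for each
-- graph of the family, p private vertices.  The i-th codeword selects k blobs,
-- which receive the k stable sets of the i-th graph.  Distance at least 2k − 2
-- means that two codewords share at most one blob, and blobs are stable, so no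
-- edge of one copy joins two vertices of another copy.

module Submission where

open import Defs
open import Data.Bool.Base using (true; false; T)
import Data.Bool.Properties as Bool
open import Data.Nat.Base using
  (ℕ; suc; pred; _+_; _*_; _∸_; _≤_; z≤n; s≤s; NonZero)
open import Data.Nat.DivMod using (_%_; m≡m%n+[m/n]*n; m%n<n)
import Data.Nat.Properties as ℕ
open import Data.Nat.Solver using (module +-*-Solver)
open import Data.Fin.Base using (Fin; zero; suc; inject≤)
open import Data.Fin.Properties using
  (_≟_; any?; injective⇒≤; inject≤-injective; *↔×; +↔⊎)
open import Data.Fin.Subset using (Subset; _∈_; ∁; ∣_∣; _∩_)
open import Data.Fin.Subset.Properties using
  (_∈?_; x∉p⇒x∈∁p; x∈p∩q⁺; ∣∁p∣≡n∸∣p∣)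
open import Data.Product.Base using (∃; _×_; _,_; proj₁; proj₂)
open import Data.Product.Function.Dependent.Propositional using (Σ-↣; Σ-↔)
open import Data.Product.Function.NonDependent.Propositional using (_×-↣_)
open import Data.Sum.Base using (_⊎_; inj₁; inj₂; [_,_])
open import Data.Sum.Properties using (inj₁-injective; inj₂-injective)
open import Data.Sum.Function.Propositional using (_⊎-↣_; _⊎-↔_)
open import Data.Vec.Base using (Vec; []; _∷_; lookup; here; there)
open import Data.Vec.Properties using (zipWith-comm)
open import Data.Vec.Relation.Unary.All.Properties using (lookup⁺)
open import Data.Vec.Relation.Unary.AllPairs using (AllPairs; _∷_)
import Data.Vec.Relation.Unary.AllPairs as AllPairs
open import Function.Base using (_∘_; case_of_)
open import Function.Bundles using
  (_↔_; _↣_; mk↔ₛ′; mk↣; mk⇔; Inverse; Injection; Equivalence)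
open import Function.Construct.Composition using (_↣-∘_; _↔-∘_)
open import Function.Construct.Identity using (↣-id; ↔-id)
open import Function.Construct.Symmetry using (↔-sym)
open import Function.Properties.Inverse using (↔⇒↣)
open import Relation.Binary.Core using (Rel)
open import Relation.Binary.Definitions using (Symmetric)
open import Relation.Binary.PropositionalEquality
  using (_≡_; _≢_; refl; sym; trans; subst; cong; cong₂; module ≡-Reasoning)
open import Relation.Nullary.Decidable
  using (Dec; yes; no; does; _×-dec_; T?; dec-false; does-⇔)
open import Relation.Nullary.Negation using (¬_; contradiction)

-- Preliminaries on pairwise relations and ceilings.

module _ {a ℓ} {A : Set a} {R : Rel A ℓ} (R-sym : Symmetric R) where

  -- `AllPairs` relates each entry only to later ones; symmetry of `R` supplies the reverse order.
  lookup-AllPairs : ∀ {n} {xs : Vec A n} → AllPairs R xs →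
                    ∀ {i j} → i ≢ j → R (lookup xs i) (lookup xs j)
  lookup-AllPairs (_  ∷ _)   {zero}  {zero}  i≢j = contradiction refl i≢j
  lookup-AllPairs (rs ∷ _)   {zero}  {suc j} _   = lookup⁺ rs j
  lookup-AllPairs (rs ∷ _)   {suc i} {zero}  _   = R-sym (lookup⁺ rs i)
  lookup-AllPairs (_  ∷ rss) {suc i} {suc j} i≢j =
    lookup-AllPairs rss (i≢j ∘ cong suc)

-- The remainder of `m + pred k` modulo `k` is at most `pred k`, so it cancels against the summand
-- that rounds up.
m≤k*⌈m/k⌉ : ∀ m k .{{_ : NonZero k}} → m ≤ k * ⌈ m / k ⌉
m≤k*⌈m/k⌉ m k = ℕ.+-cancelˡ-≤ (pred k) _ _ (begin
  pred k + m                          ≡⟨ ℕ.+-comm (pred k) m ⟩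
  m + pred k                          ≡⟨ m≡m%n+[m/n]*n (m + pred k) k ⟩
  (m + pred k) % k + ⌈ m / k ⌉ * k    ≤⟨ ℕ.+-monoˡ-≤ _ (ℕ.<⇒≤pred (m%n<n _ k)) ⟩
  pred k + ⌈ m / k ⌉ * k              ≡⟨ cong (pred k +_) (ℕ.*-comm ⌈ m / k ⌉ k) ⟩
  pred k + k * ⌈ m / k ⌉              ∎)
  where open ℕ.≤-Reasoning

-- Subsets as finite types.

rank : ∀ {n} (S : Subset n) → ∃ (_∈ S) → Fin ∣ S ∣
rank (true  ∷ S) (zero  , here)    = zero
rank (true  ∷ S) (suc x , there p) = suc (rank S (x , p))
rank (false ∷ S) (suc x , there p) = rank S (x , p)

nth : ∀ {n} (S : Subset n) → Fin ∣ S ∣ → ∃ (_∈ S)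
nth (true  ∷ S) zero    = zero , here
nth (true  ∷ S) (suc i) = let x , p = nth S i in suc x , there p
nth (false ∷ S) i       = let x , p = nth S i in suc x , there p

rank-nth : ∀ {n} (S : Subset n) i → rank S (nth S i) ≡ i
rank-nth (true  ∷ S) zero    = refl
rank-nth (true  ∷ S) (suc i) = cong suc (rank-nth S i)
rank-nth (false ∷ S) i       = rank-nth S i

nth-rank : ∀ {n} (S : Subset n) u → nth S (rank S u) ≡ u
nth-rank (true  ∷ S) (zero  , here)    = refl
nth-rank (true  ∷ S) (suc x , there p) =
  cong (λ (y , q) → suc y , there q) (nth-rank S (x , p))
nth-rank (false ∷ S) (suc x , there p) =
  cong (λ (y , q) → suc y , there q) (nth-rank S (x , p))

∈↔Fin : ∀ {n} (S : Subset n) → ∃ (_∈ S) ↔ Fin ∣ S ∣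
∈↔Fin S = mk↔ₛ′ (rank S) (nth S) (rank-nth S) (nth-rank S)

∣S∣≤1⇒unique : ∀ {n} {S : Subset n} → ∣ S ∣ ≤ 1 →
               ∀ {x y} → x ∈ S → y ∈ S → x ≡ y
∣S∣≤1⇒unique {S = S} ≤1 {x} {y} x∈ y∈ =
  cong proj₁ (Injection.injective (↔⇒↣ (∈↔Fin S))
    (Fin≤1 ≤1 (rank S (x , x∈)) (rank S (y , y∈))))
  where
  Fin≤1 : ∀ {m} → m ≤ 1 → (i j : Fin m) → i ≡ j
  Fin≤1 (s≤s z≤n) zero zero = refl

∈-↣ : ∀ {n} {S : Subset n} → ∃ (_∈ S) ↣ Fin n
∈-↣ = mk↣ {to = proj₁} (∈-≡ _ _)

-- An injection is an induced embedding of edgeless graphs.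
image : ∀ {m n} (f : Fin m ↣ Fin n) → ∃ λ (S : Subset n) →
        ∃ λ (φ : Fin m ↔ ∃ (_∈ S)) →
        ∀ x → proj₁ (Inverse.to φ x) ≡ Injection.to f x
image {m} {n} f = proj₁ range , _≅_.vertices (proj₂ range) , λ _ → refl
  where
  edgeless : ∀ {V} → Graph V
  edgeless = record
    { adj = λ _ _ → false ; adj-sym = λ _ _ → refl ; adj-irrefl = λ _ → refl }

  range : edgeless {Fin m} ⊑ edgeless {Fin n}
  range = embedding⇒⊑ edgeless edgeless
    (Injection.to f , (λ _ _ → Injection.injective f) , λ _ _ → refl)

-- Splitting one graph into small stable sets and a remainder.

side : ∀ {n} (S : Subset n) → Fin n → ∃ (_∈ S) ⊎ ∃ (_∈ ∁ S)
side S x with x ∈? S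
... | yes x∈ = inj₁ (x , x∈)
... | no  x∉ = inj₂ (x , x∉p⇒x∈∁p x∉)

vertex : ∀ {n} (S : Subset n) → ∃ (_∈ S) ⊎ ∃ (_∈ ∁ S) → Fin n
vertex S = [ proj₁ , proj₁ ]

vertex-side : ∀ {n} (S : Subset n) x → vertex S (side S x) ≡ x
vertex-side S x with x ∈? S
... | yes _ = refl
... | no  _ = refl

side-injective : ∀ {n} (S : Subset n) {x y} → side S x ≡ side S y → x ≡ y
side-injective S {x} {y} eq =
  trans (sym (vertex-side S x)) (trans (cong (vertex S) eq) (vertex-side S y))

inject≤-↣ : ∀ {m n} → .(m ≤ n) → Fin m ↣ Fin n
inject≤-↣ m≤n = mk↣ (inject≤-injective m≤n m≤n _ _)

-- The layout of one copy before a codeword decides which blobs host its `k` classes. Vertices in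
-- the spare slots `Fin p` may have arbitrary edges.
record Placement {n} (k q p : ℕ) (G : Graph (Fin n)) : Set where
  field
    position : Fin n ↣ ((Fin k × Fin q) ⊎ Fin p)
    stable   : ∀ {x y c a b} →
      Injection.to position x ≡ inj₁ (c , a) →
      Injection.to position y ≡ inj₁ (c , b) → adj G x y ≡ false

-- Only vertices outside `S` use spare slots, and the bound on `n` leaves at most `p` of them. So
-- `S` may omit surplus vertices of color classes along with the deleted set.
place : ∀ {n k q p} {G : Graph (Fin n)} (S : Subset n) →
        n ≤ ∣ S ∣ + p → (h : ∃ (_∈ S) ↣ (Fin k × Fin q)) →
        (∀ u v → proj₁ (Injection.to h u) ≡ proj₁ (Injection.to h v) →
           adj (G [ S ]) u v ≡ false) →
        Placement k q p G
place {n} {k} {q} {p} {G} S n≤∣S∣+p h h-stable = record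
  { position = position
  ; stable   = stable
  }
  where
  overflow : ∃ (_∈ ∁ S) ↣ Fin p
  overflow = inject≤-↣ (subst (_≤ p) (sym (∣∁p∣≡n∸∣p∣ S))
                          (ℕ.m≤n+o⇒m∸n≤o n ∣ S ∣ n≤∣S∣+p))
             ↣-∘ ↔⇒↣ (∈↔Fin (∁ S))

  position : Fin n ↣ ((Fin k × Fin q) ⊎ Fin p)
  position = (h ⊎-↣ overflow) ↣-∘ mk↣ (side-injective S)

  stable : ∀ {x y c a b} →
    Injection.to position x ≡ inj₁ (c , a) →
    Injection.to position y ≡ inj₁ (c , b) → adj G x y ≡ false
  stable {x} {y} ex ey with x ∈? S | y ∈? S
  ... | yes x∈ | yes y∈ = h-stable (x , x∈) (y , y∈)
    (trans (cong proj₁ (inj₁-injective ex)) (sym (cong proj₁ (inj₁-injective ey))))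
  stable () _  | no _  | _
  stable _  () | yes _ | no _

fibres : ∀ {V C : Set} (f : V → C) → V ↔ ∃ λ c → ∃ λ x → f x ≡ c
fibres f = mk↔ₛ′ (λ x → f x , x , refl) (λ (_ , x , _) → x)
                (λ { (_ , _ , refl) → refl }) (λ _ → refl)

-- If one color class has more than q vertices, then all have at least q, and
-- exactly q vertices of each class are kept.
trim : ∀ {n k q p} {G : Graph (Fin n)} → n ≤ k * q + p →
       AlmostEquitablyColorable p k G → Placement k q p G
trim {n} {k} {q} {p} {G} n≤kq+p (X , ∣X∣≤p , coloring) =
  case any? (λ c → q ℕ.<? size c) of λ where
    (no none)       → keep-all λ c → ℕ.≮⇒≥ λ q<c → none (c , q<c)
    (yes (c , q<c)) → fill λ d → ℕ.≤-pred (ℕ.≤-trans q<c (equitable c d))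
  where
  open EquitableColoring coloring

  members : ∃ (_∈ ∁ X) ↔ ∃ (Fin ∘ size)
  members = Σ-↔ (↔-id _) (λ {c} → class-size c) ↔-∘ fibres color

  resize : ∀ {s s′ : Fin k → ℕ} → (∀ c → s c ≤ s′ c) → ∃ (Fin ∘ s) ↣ ∃ (Fin ∘ s′)
  resize s≤s′ = Σ-↣ (↔-id _) λ {c} → inject≤-↣ (s≤s′ c)

  same-color : ∀ u v → color u ≡ color v → adj (G ∖ X) u v ≡ false
  same-color u v eq = Bool.¬-not λ adjacent → proper u v adjacent eq

  keep-all : (∀ c → size c ≤ q) → Placement k q p G
  keep-all small = place (∁ X)
    -- Since `∣ X ∣ ≤ p`, at least `n ∸ p` vertices lie outside `X`.
    (subst (λ m → n ≤ m + p) (sym (∣∁p∣≡n∸∣p∣ X))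
      (ℕ.≤-trans (ℕ.m≤n+m∸n n p)
        (ℕ.≤-trans (ℕ.≤-reflexive (ℕ.+-comm p _))
          (ℕ.+-monoˡ-≤ p (ℕ.∸-monoʳ-≤ n ∣X∣≤p)))))
    (resize small ↣-∘ ↔⇒↣ members)
    same-color

  fill : (∀ c → q ≤ size c) → Placement k q p G
  fill large = place S
    -- `φ` fills all `k * q` slots with vertices of `S`, so `k * q ≤ ∣ S ∣`.
    (ℕ.≤-trans n≤kq+p (ℕ.+-monoˡ-≤ p
      (injective⇒≤ (Injection.injective (↔⇒↣ (∈↔Fin S ↔-∘ φ))))))
    (↔⇒↣ (*↔× ↔-∘ ↔-sym φ))
    kept-stable
    where
    kept : (Fin k × Fin q) ↣ ∃ (_∈ ∁ X)
    -- `resize` starts from the constant size `q`: the first `q` members of each class, in the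
    -- numbering of `class-size`, are kept.
    kept = ↔⇒↣ (↔-sym members) ↣-∘ resize large

    kept-color : ∀ u → color (Injection.to kept u) ≡ proj₁ u
    kept-color u = cong proj₁
      (Inverse.strictlyInverseˡ members (Injection.to (resize large) u))

    choose : Fin (k * q) ↣ Fin n
    choose = ∈-↣ ↣-∘ (kept ↣-∘ ↔⇒↣ *↔×)

    S = proj₁ (image choose)
    φ = proj₁ (proj₂ (image choose))

    slot : ∃ (_∈ S) → Fin k × Fin q
    slot = Inverse.to (*↔× ↔-∘ ↔-sym φ)

    kept-slot : ∀ u → proj₁ (Injection.to kept (slot u)) ≡ proj₁ u
    kept-slot u = trans (sym (proj₂ (proj₂ (image choose)) (Inverse.from φ u)))
                        (cong proj₁ (Inverse.strictlyInverseˡ φ u))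

    kept-stable : ∀ u v → proj₁ (slot u) ≡ proj₁ (slot v) → adj (G [ S ]) u v ≡ false
    kept-stable u v eq = trans
      (sym (cong₂ (adj G) (kept-slot u) (kept-slot v)))
      (same-color (Injection.to kept (slot u)) (Injection.to kept (slot v))
        (trans (kept-color (slot u)) (trans eq (sym (kept-color (slot v))))))

-- Overlaying copies of the graphs.

-- The edges of `U` are the images of the edges of all `F j`. By `disjoint`, an edge with both ends
-- in copy `i` comes from `F i` itself, so every copy is induced.
superpose : ∀ {t n m} (F : Fin t → Graph (Fin n)) (e : Fin t → Fin n ↣ Fin m) →
  (∀ {i j x y x′ y′} → adj (F j) x′ y′ ≡ true →
     Injection.to (e j) x′ ≡ Injection.to (e i) x →
     Injection.to (e j) y′ ≡ Injection.to (e i) y → j ≡ i) →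
  HasInducedUniversal F m
superpose {m = m} F e disjoint = U , λ i → embedding⇒⊑ (F i) U
  (Injection.to (e i) , (λ _ _ → Injection.injective (e i)) , preserved i)
  where
  Edge : Fin m → Fin m → Set
  Edge u v = ∃ λ j → ∃ λ x → ∃ λ y → adj (F j) x y ≡ true ×
    Injection.to (e j) x ≡ u × Injection.to (e j) y ≡ v

  edge? : ∀ u v → Dec (Edge u v)
  edge? u v = any? λ j → any? λ x → any? λ y → adj (F j) x y Bool.≟ true ×-dec
    Injection.to (e j) x ≟ u ×-dec Injection.to (e j) y ≟ v

  Edge-sym : ∀ {u v} → Edge u v → Edge v u
  Edge-sym (j , x , y , xy , ex , ey) =
    j , y , x , trans (adj-sym (F j) y x) xy , ey , ex

  Edge-irrefl : ∀ {u} → ¬ Edge u u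
  Edge-irrefl (j , x , y , xy , ex , ey)
    with refl ← Injection.injective (e j) (trans ex (sym ey))
    with () ← trans (sym (adj-irrefl (F j) x)) xy

  U : Graph (Fin m)
  U = record
    { adj        = λ u v → does (edge? u v)
    ; adj-sym    = λ u v → does-⇔ (mk⇔ Edge-sym Edge-sym) (edge? u v) (edge? v u)
    ; adj-irrefl = λ u → dec-false (edge? u u) Edge-irrefl
    }

  reflected : ∀ i x y →
    Edge (Injection.to (e i) x) (Injection.to (e i) y) → T (adj (F i) x y)
  reflected i x y (j , x′ , y′ , xy , ex , ey)
    with refl ← disjoint xy ex ey
    with refl ← Injection.injective (e i) ex
    with refl ← Injection.injective (e i) ey = Equivalence.from Bool.T-≡ xy

  preserved : ∀ i x y →
    adj U (Injection.to (e i) x) (Injection.to (e i) y) ≡ adj (F i) x y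
  preserved i x y = does-⇔
    (mk⇔ (reflected i x y)
         (λ xy → i , x , y , Equivalence.to Bool.T-≡ xy , refl , refl))
    (edge? _ _) (T? (adj (F i) x y))

-- Distance and intersection of codewords.

-- Position by position: a 1 in exactly one word counts once on each side, a common 1 counts twice.
∣x∣+∣y∣≡hamming+2∣x∩y∣ : ∀ {n} (x y : Word n) →
  weight x + weight y ≡ hamming x y + 2 * weight (x ∩ y)
∣x∣+∣y∣≡hamming+2∣x∩y∣ []          []          = refl
∣x∣+∣y∣≡hamming+2∣x∩y∣ (false ∷ x) (false ∷ y) = ∣x∣+∣y∣≡hamming+2∣x∩y∣ x y
∣x∣+∣y∣≡hamming+2∣x∩y∣ (true  ∷ x) (false ∷ y) = cong suc (∣x∣+∣y∣≡hamming+2∣x∩y∣ x y)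
∣x∣+∣y∣≡hamming+2∣x∩y∣ (false ∷ x) (true  ∷ y) =
  trans (ℕ.+-suc _ _) (cong suc (∣x∣+∣y∣≡hamming+2∣x∩y∣ x y))
∣x∣+∣y∣≡hamming+2∣x∩y∣ (true  ∷ x) (true  ∷ y) = begin
  suc (weight x + suc (weight y))
    ≡⟨ cong suc (ℕ.+-suc _ _) ⟩
  2 + (weight x + weight y)
    ≡⟨ cong (2 +_) (∣x∣+∣y∣≡hamming+2∣x∩y∣ x y) ⟩
  2 + (hamming x y + 2 * weight (x ∩ y))
    ≡⟨ solve 2 (λ h m → con 2 :+ (h :+ con 2 :* m) := h :+ con 2 :* (con 1 :+ m))
         refl (hamming x y) (weight (x ∩ y)) ⟩
  hamming x y + 2 * suc (weight (x ∩ y)) ∎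
  where
  open ≡-Reasoning
  open +-*-Solver

∣x∩y∣≤1 : ∀ {n} k (x y : Word n) → weight x ≡ k → weight y ≡ k →
          2 * k ∸ 2 ≤ hamming x y → ∣ x ∩ y ∣ ≤ 1
∣x∩y∣≤1 k x y wx wy d≤ = ℕ.*-cancelˡ-≤ 2 (ℕ.+-cancelˡ-≤ (hamming x y) _ _ (begin
  hamming x y + 2 * ∣ x ∩ y ∣  ≡⟨ ∣x∣+∣y∣≡hamming+2∣x∩y∣ x y ⟨
  weight x + weight y          ≡⟨ cong₂ _+_ wx (trans wy (sym (ℕ.+-identityʳ k))) ⟩
  -- An inequality only, because the subtraction truncates when `k` is 0.
  2 * k                        ≤⟨ ℕ.m≤n+m∸n (2 * k) 2 ⟩
  2 + (2 * k ∸ 2)              ≤⟨ ℕ.+-monoʳ-≤ 2 d≤ ⟩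
  2 + hamming x y              ≡⟨ ℕ.+-comm 2 _ ⟩
  hamming x y + 2              ∎))
  where open ℕ.≤-Reasoning

-- The universal graph built from a code.

module Construction {s t k q p n : ℕ}
  (word : Fin t → Word s)
  (word-weight : ∀ i → weight (word i) ≡ k)
  (meet≤1 : ∀ {i j} → i ≢ j → ∣ word i ∩ word j ∣ ≤ 1)
  (F : Fin t → Graph (Fin n))
  (placement : ∀ i → Placement k q p (F i))
  where

  open module P i = Placement (placement i)

  -- The `c`-th position holding a 1 in `word i` is the blob that hosts class `c` of graph `i`.
  blob : ∀ i → Fin k ↣ ∃ (_∈ word i)
  blob i = subst (λ m → Fin m ↣ ∃ (_∈ word i)) (word-weight i)
                 (↔⇒↣ (↔-sym (∈↔Fin (word i))))

  locate : ∀ i → ((Fin k × Fin q) ⊎ Fin p) ↣ ((Fin s × Fin q) ⊎ (Fin t × Fin p))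
  locate i = ((∈-↣ ↣-∘ blob i) ×-↣ ↣-id _)
           ⊎-↣ mk↣ {to = i ,_} (cong proj₂)

  Shared : Fin t → Fin t → (Fin k × Fin q) ⊎ Fin p → Set
  Shared i j u = ∃ λ c → ∃ λ a →
    u ≡ inj₁ (c , a) × proj₁ (Injection.to (blob j) c) ∈ word i ∩ word j

  -- Private vertices carry the index of their copy, so two copies can collide only in a blob
  -- selected by both words.
  shared : ∀ {i j} u v → i ≢ j →
    Injection.to (locate j) u ≡ Injection.to (locate i) v → Shared i j u
  shared {i} {j} (inj₁ (c , a)) (inj₁ (d , _)) _ eq = c , a , refl , x∈p∩q⁺
    ( subst (_∈ word i) (sym (cong proj₁ (inj₁-injective eq)))
        (proj₂ (Injection.to (blob i) d))
    , proj₂ (Injection.to (blob j) c) )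
  shared (inj₂ _) (inj₂ _) i≢j eq =
    contradiction (sym (cong proj₁ (inj₂-injective eq))) i≢j

  -- A numbering of the vertices, blobs first and private vertices after; not a binary code.
  code : ((Fin s × Fin q) ⊎ (Fin t × Fin p)) ↔ Fin (s * q + t * p)
  code = ↔-sym ((*↔× ⊎-↔ *↔×) ↔-∘ +↔⊎)

  embed : Fin t → Fin n ↣ Fin (s * q + t * p)
  embed i = ↔⇒↣ code ↣-∘ (locate i ↣-∘ position i)

  -- The two words have at most one common position, so `x` and `y` lie in the same blob and hence
  -- in one stable class of `F j`.
  stable-across : ∀ {i j x y} → i ≢ j → Shared i j (Injection.to (position j) x) →
    Shared i j (Injection.to (position j) y) → adj (F j) x y ≡ false
  stable-across {j = j} i≢j (c , a , ex , c∈) (d , b , ey , d∈)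
    with refl ← Injection.injective (blob j) (∈-≡ _ _ (∣S∣≤1⇒unique (meet≤1 i≢j) c∈ d∈))
    = stable j ex ey

  universal : HasInducedUniversal F (s * q + t * p)
  universal = superpose F embed λ {i} {j} {x} {y} {x′} {y′} xy ex ey →
    case j ≟ i of λ where
      (yes j≡i) → j≡i
      (no  j≢i) →
        let shared′ = λ x x′ eq →
              shared (Injection.to (position j) x′) (Injection.to (position i) x)
                     (j≢i ∘ sym) (Injection.injective (↔⇒↣ code) eq)
        in case trans (sym xy)
                  (stable-across (j≢i ∘ sym) (shared′ x x′ ex) (shared′ y y′ ey))
           of λ ()

theorem3 : (s t k : ℕ) .{{_ : NonZero k}} →
    t ≤ A s (2 * k ∸ 2) k →
    (n p : ℕ) (F : Fin t → Graph (Fin n)) →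
    (∀ i → AlmostEquitablyColorable p k (F i)) →
    𝒰 F ≤ s * ⌈ n ∸ p / k ⌉ + t * p
theorem3 s t k t≤A n p F colorable =
  let words , weights , separated = proj₁ (A-isMaximum s (2 * k ∸ 2) k)
      -- The first `t` words of a maximum code suffice.
      word = λ i → lookup words (inject≤ i t≤A)
      word-weight = λ i → lookup⁺ weights (inject≤ i t≤A)
      meet≤1 = λ {i j} (i≢j : i ≢ j) →
        ∣x∩y∣≤1 k (word i) (word j) (word-weight i) (word-weight j)
          (lookup-AllPairs
            (λ {x} {y} → subst (2 * k ∸ 2 ≤_)
              (cong ∣_∣ (zipWith-comm Bool.xor-comm x y)))
            (AllPairs.map proj₂ separated) (i≢j ∘ inject≤-injective t≤A t≤A i j))
      -- With `q = ⌈ n ∸ p / k ⌉` this is the capacity bound `n ≤ k * q + p` that `trim` requires;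
      -- it also covers `n < p`, where `n ∸ p` is 0.
      n≤ = ℕ.≤-trans (ℕ.m≤n+m∸n n p) (ℕ.≤-trans
        (ℕ.+-monoʳ-≤ p (m≤k*⌈m/k⌉ (n ∸ p) k)) (ℕ.≤-reflexive (ℕ.+-comm p _)))
  in proj₂ (𝒰-isMinimum F) _
       (Construction.universal word word-weight meet≤1 F (trim n≤ ∘ colorable))
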